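{- The generating function $G^{(2)}_{n}(r)=G^{(2)}_{n}(m,r,s)$ of dimer configurations on the segment $[0,n]$ satisfying (C1), (C2) and (C3) satisfies, for $n\ge 2$, the recurrence relation $$G^{(2)}_{n}(r)=(1+rs(m-2))G^{(2)}_{n-1}(rs)+rs\,G^{(2)}_{n-2}(rs^2)+rs(1+rs^2(m-1))G^{(2)}_{n-3}(rs^3)+r^2s^3G^{(2)}_{n-4}(rs^{4}),$$ with the initial conditions $G^{(2)}_{i}(m,r,s)=1$ for $i\le 0$ and $G^{(2)}_{1}(m,r,s)=1+rsm$.
   Context: Let $v_0,\dots,v_n$ be the vertices of the segment $[0,n]$. A dimer at position $i$ ($1\le i\le n$) is an edge connecting $v_{i-1}$ and $v_i$; each dimer carries one of $m$ colors. The conditions on a configuration are: (C1) there is at most one dimer at each position $i$; (C2) two dimers at adjacent positions $i,i+1$ have different colors; (C3) two dimers with the same color have distance at least two, where the distance between dimers at positions $i<j$ is $j-i-1$, the number of positions strictly between them (so dimers of the same color are at positions differing by at least $3$). $G^{(2)}_n(m,r,s)$ is the sum, over all colored configurations, of $r^{b}s^{c}$, where $b$ is the number of dimers and $c$ is the sum of the positions of the dimers. By convention $G^{(2)}_i=1$ for $i\le 0$. The notation $G^{(2)}_{i}(rs^p)$ means $G^{(2)}_i(m,rs^p,s)$. -}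

module Defs where

open import Algebra.Bundles using (CommutativeRing)
open import Data.Fin.Base using (Fin; toℕ; _<_)
open import Data.Fin.Properties using (all?; _≟_; _<?_)
open import Data.Fin.Subset using (Subset; inside; outside; _∈_; ∣_∣)
open import Data.Fin.Subset.Properties using (_∈?_)
open import Data.Integer.Base using (ℤ; +_; -[1+_])
open import Data.List.Base as List using (List; []; _∷_; cartesianProductWith; filter; foldr)
open import Data.Nat.Base as ℕ using (ℕ; zero; suc; _∸_; _≤_)
import Data.Nat.Properties as ℕ
open import Data.Product.Base using (_×_)
open import Data.Vec.Base as Vec using (Vec; []; _∷_; lookup; tabulate)
open import Relation.Binary.PropositionalEquality.Core using (_≡_; _≢_)
open import Relation.Nullary.Decidable using (Dec; _×-dec_; _→-dec_; ¬?)

-- An arbitrary set of coloured dimers on [0, n]: each position is sent to the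
-- set of colours of the dimers placed there.  The index i : Fin n stands for
-- the position suc (toℕ i), i.e. the edge from v_{toℕ i} to v_{suc (toℕ i)}.
DimerSet : (m n : ℕ) → Set
DimerSet m n = Vec (Subset m) n

position : ∀ {n} → Fin n → ℕ
position i = suc (toℕ i)

-- Number of positions strictly between i and j; only meaningful for i < j.
distance : ∀ {n} → Fin n → Fin n → ℕ
distance i j = position j ∸ position i ∸ 1

module _ {m n : ℕ} (D : DimerSet m n) where

  C1 : Set
  C1 = ∀ i → ∣ lookup D i ∣ ≤ 1

  C2 : Set
  C2 = ∀ i j → position j ≡ suc (position i) →
       ∀ c d → c ∈ lookup D i → d ∈ lookup D j → c ≢ d

  C3 : Set
  C3 = ∀ i j → i < j → ∀ c → c ∈ lookup D i → c ∈ lookup D j → 2 ≤ distance i j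

  Admissible : Set
  Admissible = C1 × C2 × C3

  C1? : Dec C1
  C1? = all? λ i → ∣ lookup D i ∣ ℕ.≤? 1

  C2? : Dec C2
  C2? = all? λ i → all? λ j → (position j ℕ.≟ suc (position i)) →-dec
        (all? λ c → all? λ d →
          (c ∈? lookup D i) →-dec ((d ∈? lookup D j) →-dec ¬? (c ≟ d)))

  C3? : Dec C3
  C3? = all? λ i → all? λ j → (i <? j) →-dec
        (all? λ c →
          (c ∈? lookup D i) →-dec ((c ∈? lookup D j) →-dec (2 ℕ.≤? distance i j)))

  admissible? : Dec Admissible
  admissible? = C1? ×-dec (C2? ×-dec C3?)

  numberOfDimers : ℕ
  numberOfDimers = Vec.sum (tabulate λ i → ∣ lookup D i ∣)

  sumOfPositions : ℕ
  sumOfPositions = Vec.sum (tabulate λ i → position i ℕ.* ∣ lookup D i ∣)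

-- Every vector over the entries of xs, exactly once if xs has no repetitions.
allVecs : ∀ {A : Set} → List A → (n : ℕ) → List (Vec A n)
allVecs xs zero    = [] ∷ []
allVecs xs (suc n) = cartesianProductWith _∷_ xs (allVecs xs n)

allSubsets : (m : ℕ) → List (Subset m)
allSubsets = allVecs (outside ∷ inside ∷ [])

configurations : (m n : ℕ) → List (DimerSet m n)
configurations m n = filter admissible? (allVecs (allSubsets m) n)

-- The generating function is a polynomial in r and s with integer
-- coefficients; it is given by its values at elements r, s of an arbitrary
-- commutative ring, ℤ[r,s] with its two generators being the universal case.
module GeneratingFunction {a ℓ} (R : CommutativeRing a ℓ) where

  open CommutativeRing R
  open import Algebra.Properties.Semiring.Exp semiring public using (_^_)
  open import Algebra.Properties.Semiring.Mult semiring using () renaming (_×_ to _·_)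

  ⟦_⟧ : ℕ → Carrier
  ⟦ k ⟧ = k · 1#

  weight : ∀ {m n} → Carrier → Carrier → DimerSet m n → Carrier
  weight r s D = r ^ numberOfDimers D * s ^ sumOfPositions D

  G⁽²⁾ : ℤ → ℕ → Carrier → Carrier → Carrier
  G⁽²⁾ (+ n)    m r s = foldr _+_ 0# (List.map (weight r s) (configurations m n))
  G⁽²⁾ -[1+ _ ] m r s = 1#

{-# OPTIONS --safe #-}
module Submission where

-- The dimers allowed at a position depend only on the two positions before it, and the number of
-- continuations depends only on whether each of those two is occupied.  Peeling off the first
-- position therefore gives a linear system for four generating functions T i j with i, j ∈ {0, 1},
-- where T 0 0 = G⁽²⁾; each step replaces r by r s.  With q = m − 2 and G = T 0 0 it yields
--   m T₁₀ₙ(r)        = (m−1) Gₙ(r) + Gₙ₋₁(rs),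
--   m (m−1) T₁₁ₙ(r)  = m q T₀₁ₙ(r) + (m−1) Gₙ₋₁(rs) + Gₙ₋₂(rs²),
-- hence m T₀₁ₙ in terms of G alone, and Gₙ₊₁(r) = Gₙ(rs) + m r s T₀₁ₙ(rs) is the recurrence.

open import Defs
open import Algebra.Bundles using (CommutativeRing)
open import Data.Bool.Base using (if_then_else_)
open import Data.Empty using (⊥-elim)
open import Data.Fin.Base using (Fin; zero; suc; toℕ)
open import Data.Fin.Properties using (toℕ-↑ˡ)
open import Data.Fin.Subset using (Subset; inside; outside; _∈_; _∉_; ∣_∣; ⊥; ⁅_⁆)
open import Data.Fin.Subset.Properties using (_∈?_; ∉⊥; ∣⊥∣≡0; ∣⁅x⁆∣≡1; x∈⁅x⁆; x∈⁅y⁆⇒x≡y)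
open import Data.Integer.Base as ℤ using (ℤ; 0ℤ; 1ℤ; _⊖_)
import Data.Integer.Properties as ℤ
open import Data.List.Base as List using (List; []; _∷_; _++_; cartesianProductWith; filter; foldr)
open import Data.Nat.Base as ℕ using (ℕ; zero; suc; _≤_; z≤n; s≤s)
import Data.Nat.Properties as ℕ
open import Data.Product.Base using (_×_; _,_; proj₁; proj₂)
open import Data.Vec.Base as Vec using ([]; _∷_; lookup)
open import Data.Vec.Properties using (lookup-++ˡ)
open import Function.Base using (_∘_)
open import Function.Bundles using (Equivalence; _⇔_; mk⇔)
open import Relation.Binary.PropositionalEquality.Core as ≡ using (_≡_)
open import Relation.Nullary.Decidable using (Dec; yes; no; dec-true; dec-false; does; does-⇔)
open import Relation.Nullary.Negation using (¬_)
open import Relation.Unary using (Pred; Decidable)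

-- Admissibility, tested one position at a time.

private variable
  m n k : ℕ

-- The constraints between a new first position and the rest. Index `j` of `D` has distance `toℕ j`
-- from that position, so the bound is C3; at `j = 0` it excludes every shared colour, which is C2.
Separated : Subset m → DimerSet m n → Set
Separated a D = ∀ j c → c ∈ a → c ∈ lookup D j → 2 ≤ toℕ j

admissible-[] : Admissible {m} []
admissible-[] = (λ ()) , (λ ()) , (λ ())

admissible-∷⁻ : {a : Subset m} {D : DimerSet m n} → Admissible (a ∷ D) →
                ∣ a ∣ ≤ 1 × Separated a D × Admissible D
admissible-∷⁻ (c1 , c2 , c3) =
  c1 zero ,
  (λ j c → c3 zero (suc j) (s≤s z≤n) c) ,
  (λ i → c1 (suc i)) ,
  (λ i j eq → c2 (suc i) (suc j) (≡.cong suc eq)) ,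
  (λ i j i<j → c3 (suc i) (suc j) (s≤s i<j))

admissible-∷⁺ : {a : Subset m} {D : DimerSet m n} →
                ∣ a ∣ ≤ 1 → Separated a D → Admissible D → Admissible (a ∷ D)
admissible-∷⁺ {a = a} {D} ∣a∣≤1 sep (c1 , c2 , c3) = c1′ , c2′ , c3′
  where
  c1′ : C1 (a ∷ D)
  c1′ zero    = ∣a∣≤1
  c1′ (suc i) = c1 i

  c2′ : C2 (a ∷ D)
  -- Adjacent positions have distance 0, so a shared colour would give `2 ≤ 0`.
  c2′ zero (suc zero) _ c .c c∈a c∈D ≡.refl with () ← sep zero c c∈a c∈D
  c2′ (suc i) (suc j) eq = c2 i j (ℕ.suc-injective eq)

  c3′ : C3 (a ∷ D)
  c3′ zero    (suc j) _         = sep j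
  c3′ (suc i) (suc j) (s≤s i<j) = c3 i j i<j

separated-++⁻ : {a : Subset m} (D : DimerSet m n) {E : DimerSet m k} →
                Separated a (D Vec.++ E) → Separated a D
separated-++⁻ {k = k} D {E} sep j c c∈a c∈D =
  ≡.subst (2 ≤_) (toℕ-↑ˡ j k)
    (sep _ c c∈a (≡.subst (c ∈_) (≡.sym (lookup-++ˡ D E j)) c∈D))

-- Used contrapositively: an inadmissible prefix has no admissible continuation.
admissible-++⁻ : (D : DimerSet m n) {E : DimerSet m k} →
                 Admissible (D Vec.++ E) → Admissible D
admissible-++⁻ []      _   = admissible-[]
admissible-++⁻ (a ∷ D) adm =
  let ∣a∣≤1 , sep , adm′ = admissible-∷⁻ adm
  in admissible-∷⁺ ∣a∣≤1 (separated-++⁻ D sep) (admissible-++⁻ D adm′)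

admissible-⊥∷ : {D : DimerSet m n} → Admissible D ⇔ Admissible (⊥ ∷ D)
admissible-⊥∷ {m} = mk⇔
  (admissible-∷⁺ (≡.subst (_≤ 1) (≡.sym (∣⊥∣≡0 m)) z≤n) (λ _ _ → ⊥-elim ∘ ∉⊥))
  (proj₂ ∘ proj₂ ∘ admissible-∷⁻)

-- Locality of the constraints: every position of `D` is at distance at least 2 from `a`, so `a`
-- restricts only `b` and `S`, and `adm` already covers those.
admissible-window : {a b S : Subset m} (D : DimerSet m n) → Admissible (a ∷ b ∷ S ∷ []) →
                    Admissible (a ∷ b ∷ S ∷ D) ⇔ Admissible (b ∷ S ∷ D)
admissible-window {m} {a = a} {b} {S} D adm = mk⇔ (proj₂ ∘ proj₂ ∘ admissible-∷⁻)
  (admissible-∷⁺ (proj₁ (admissible-∷⁻ adm)) sep)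
  where
  sep : Separated a (b ∷ S ∷ D)
  sep zero          = proj₁ (proj₂ (admissible-∷⁻ adm)) zero
  sep (suc zero)    = proj₁ (proj₂ (admissible-∷⁻ adm)) (suc zero)
  sep (suc (suc j)) _ _ _ = s≤s (s≤s z≤n)

module _ {a b : Subset m} (adm : Admissible (a ∷ b ∷ [])) where

  admissible⇒disjoint : ∀ {c} → c ∈ a → c ∉ b
  admissible⇒disjoint c∈a c∈b with () ← proj₁ (proj₂ (admissible-∷⁻ adm)) zero _ c∈a c∈b

  admissible-extend : {S : Subset m} → ∣ S ∣ ≤ 1 → (∀ {c} → c ∈ S → c ∉ a × c ∉ b) →
                      Admissible (a ∷ b ∷ S ∷ [])
  admissible-extend {S} ∣S∣≤1 new =
    admissible-∷⁺ (proj₁ (admissible-∷⁻ adm)) sep-a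
      (admissible-∷⁺ (proj₁ (admissible-∷⁻ (proj₂ (proj₂ (admissible-∷⁻ adm))))) sep-b
        (admissible-∷⁺ ∣S∣≤1 (λ ()) admissible-[]))
    where
    sep-a : Separated a (b ∷ S ∷ [])
    sep-a zero       c c∈a c∈b = ⊥-elim (admissible⇒disjoint c∈a c∈b)
    sep-a (suc zero) c c∈a c∈S = ⊥-elim (proj₁ (new c∈S) c∈a)

    sep-b : Separated b (S ∷ [])
    sep-b zero c c∈b c∈S = ⊥-elim (proj₂ (new c∈S) c∈b)

  admissible-extend-⊥ : Admissible (a ∷ b ∷ ⊥ ∷ [])
  admissible-extend-⊥ = admissible-extend (≡.subst (_≤ 1) (≡.sym (∣⊥∣≡0 m)) z≤n) (⊥-elim ∘ ∉⊥)

  admissible-extend-⁅⁆ : ∀ {c} → c ∉ a → c ∉ b → Admissible (a ∷ b ∷ ⁅ c ⁆ ∷ [])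
  admissible-extend-⁅⁆ {c} c∉a c∉b = admissible-extend (ℕ.≤-reflexive (∣⁅x⁆∣≡1 c))
    λ {d} d∈⁅c⁆ → ≡.subst (λ e → e ∉ a × e ∉ b) (≡.sym (x∈⁅y⁆⇒x≡y c d∈⁅c⁆)) (c∉a , c∉b)

admissible-extend-⁅⁆⁻ : {a b : Subset m} {c : Fin m} → Admissible (a ∷ b ∷ ⁅ c ⁆ ∷ []) → c ∉ a × c ∉ b
admissible-extend-⁅⁆⁻ {c = c} adm with admissible-∷⁻ adm
... | _ , sep-a , adm′ with admissible-∷⁻ adm′
... | _ , sep-b , _ =
  -- Sharing `c` with `a` would give `2 ≤ 1`, sharing it with `b` would give `2 ≤ 0`.
  (λ c∈a → ℕ.<-irrefl ≡.refl (sep-a (suc zero) c c∈a (x∈⁅x⁆ c))) ,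
  (λ c∈b → ℕ.n≮0 (sep-b zero c c∈b (x∈⁅x⁆ c)))

module _ {a ℓ} (R : CommutativeRing a ℓ) where

  open CommutativeRing R hiding (zero)
  open GeneratingFunction R
  open import Algebra.Properties.AbelianGroup +-abelianGroup using (//-rightDividesˡ; //-rightDividesʳ)
  open import Algebra.Properties.CommutativeSemiring.Exp commutativeSemiring using (^-distrib-*)
  open import Algebra.Properties.Semiring.Exp semiring using (^-homo-*)
  open import Algebra.Properties.Semiring.Mult semiring using (×-homo-+)
  open import Algebra.Properties.Semiring.Sum semiring using (sum; sum-syntax; sum-cong-≋; sum-replicate; ∑-distrib-+; *-distribʳ-sum)
  open import Algebra.Solver.Ring.NaturalCoefficients.Default commutativeSemiring using (solve; _:=_; _:+_; _:*_; _:^_; con)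
  open import Relation.Binary.Reasoning.Setoid setoid

  -- Finite sums and indicators.

  x+y≈z⇒x≈z-y : ∀ {x y z} → x + y ≈ z → x ≈ z - y
  x+y≈z⇒x≈z-y {x} {y} eq = trans (sym (//-rightDividesʳ y x)) (+-congʳ eq)

  -- The same fold as in `G⁽²⁾`, which is therefore definitionally such a sum.
  ∑ᴸ : ∀ {A : Set} → List A → (A → Carrier) → Carrier
  ∑ᴸ xs f = foldr _+_ 0# (List.map f xs)

  ∑ᴸ-cong : ∀ {A : Set} {f g : A → Carrier} (xs : List A) → (∀ x → f x ≈ g x) → ∑ᴸ xs f ≈ ∑ᴸ xs g
  ∑ᴸ-cong []       f≈g = refl
  ∑ᴸ-cong (x ∷ xs) f≈g = +-cong (f≈g x) (∑ᴸ-cong xs f≈g)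

  ∑ᴸ-zero : ∀ {A : Set} {f : A → Carrier} (xs : List A) → (∀ x → f x ≈ 0#) → ∑ᴸ xs f ≈ 0#
  ∑ᴸ-zero []       f≈0 = refl
  ∑ᴸ-zero (x ∷ xs) f≈0 = trans (+-cong (f≈0 x) (∑ᴸ-zero xs f≈0)) (+-identityˡ 0#)

  *-distribˡ-∑ᴸ : ∀ {A : Set} {f : A → Carrier} y (xs : List A) → ∑ᴸ xs (λ x → y * f x) ≈ y * ∑ᴸ xs f
  *-distribˡ-∑ᴸ y []       = sym (zeroʳ y)
  *-distribˡ-∑ᴸ y (x ∷ xs) = trans (+-congˡ (*-distribˡ-∑ᴸ y xs)) (sym (distribˡ y _ _))

  ∑ᴸ-map-++ : ∀ {A B : Set} {f : B → Carrier} (g : A → B) (xs : List A) (ys : List B) →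
              ∑ᴸ (List.map g xs ++ ys) f ≈ ∑ᴸ xs (f ∘ g) + ∑ᴸ ys f
  ∑ᴸ-map-++ g []       ys = sym (+-identityˡ _)
  ∑ᴸ-map-++ g (x ∷ xs) ys = trans (+-congˡ (∑ᴸ-map-++ g xs ys)) (sym (+-assoc _ _ _))

  ∑ᴸ-cartesianProductWith : ∀ {A B C : Set} {f : C → Carrier} (g : A → B → C) xs ys →
    ∑ᴸ (cartesianProductWith g xs ys) f ≈ ∑ᴸ xs (λ x → ∑ᴸ ys (λ y → f (g x y)))
  ∑ᴸ-cartesianProductWith g []       ys = refl
  ∑ᴸ-cartesianProductWith g (x ∷ xs) ys =
    trans (∑ᴸ-map-++ (g x) ys _) (+-congˡ (∑ᴸ-cartesianProductWith g xs ys))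

  𝟙 : ∀ {p} {P : Set p} → Dec P → Carrier
  𝟙 P? = if does P? then 1# else 0#

  module _ {p} {P : Set p} (P? : Dec P) where

    𝟙-true : P → 𝟙 P? ≈ 1#
    𝟙-true p = reflexive (≡.cong (if_then 1# else 0#) (dec-true P? p))

    𝟙-false : ¬ P → 𝟙 P? ≈ 0#
    𝟙-false ¬p = reflexive (≡.cong (if_then 1# else 0#) (dec-false P? ¬p))

    𝟙-cong : ∀ {q} {Q : Set q} (Q? : Dec Q) → P ⇔ Q → 𝟙 P? ≈ 𝟙 Q?
    𝟙-cong Q? P⇔Q = reflexive (≡.cong (if_then 1# else 0#) (does-⇔ P⇔Q P? Q?))

  -- Trades the filter for an indicator factor: the sum then runs over a full product and can be
  -- split at its first entry.
  ∑ᴸ-filter : ∀ {A : Set} {p} {P : Pred A p} (P? : Decidable P) {f : A → Carrier} xs →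
              ∑ᴸ (filter P? xs) f ≈ ∑ᴸ xs (λ x → 𝟙 (P? x) * f x)
  ∑ᴸ-filter P? []       = refl
  ∑ᴸ-filter P? (x ∷ xs) with P? x
  ... | yes _ = +-cong (sym (*-identityˡ _)) (∑ᴸ-filter P? xs)
  ... | no  _ = trans (sym (+-identityˡ _)) (+-cong (sym (zeroˡ _)) (∑ᴸ-filter P? xs))

  -- Sums over sets of colours.

  ∑ᴸ-allSubsets-suc : (f : Subset (suc m) → Carrier) →
    ∑ᴸ (allSubsets (suc m)) f ≈ ∑ᴸ (allSubsets m) (f ∘ (outside ∷_)) + ∑ᴸ (allSubsets m) (f ∘ (inside ∷_))
  ∑ᴸ-allSubsets-suc {m} f = trans
    (∑ᴸ-cartesianProductWith _∷_ (outside ∷ inside ∷ []) (allSubsets m))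
    (+-congˡ (+-identityʳ _))

  ∑ᴸ-allSubsets-⊥ : (f : Subset m → Carrier) → (∀ S → ¬ ∣ S ∣ ≤ 0 → f S ≈ 0#) →
                    ∑ᴸ (allSubsets m) f ≈ f ⊥
  ∑ᴸ-allSubsets-⊥ {zero}  f f≈0 = +-identityʳ _
  ∑ᴸ-allSubsets-⊥ {suc m} f f≈0 = begin
    ∑ᴸ (allSubsets (suc m)) f
      ≈⟨ ∑ᴸ-allSubsets-suc f ⟩
    ∑ᴸ (allSubsets m) (f ∘ (outside ∷_)) + ∑ᴸ (allSubsets m) (f ∘ (inside ∷_))
      ≈⟨ +-cong (∑ᴸ-allSubsets-⊥ _ λ S → f≈0 (outside ∷ S))
                (∑ᴸ-zero (allSubsets m) λ S → f≈0 (inside ∷ S) λ ()) ⟩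
    f ⊥ + 0#
      ≈⟨ +-identityʳ _ ⟩
    f ⊥ ∎

  -- Induction on the number of colours: without the first colour the induction hypothesis applies;
  -- with it, only the empty remainder contributes.
  ∑ᴸ-allSubsets : (f : Subset m → Carrier) → (∀ S → ¬ ∣ S ∣ ≤ 1 → f S ≈ 0#) →
                  ∑ᴸ (allSubsets m) f ≈ f ⊥ + ∑[ c < m ] f ⁅ c ⁆
  ∑ᴸ-allSubsets {zero}  f f≈0 = refl
  ∑ᴸ-allSubsets {suc m} f f≈0 = begin
    ∑ᴸ (allSubsets (suc m)) f
      ≈⟨ ∑ᴸ-allSubsets-suc f ⟩
    ∑ᴸ (allSubsets m) (f ∘ (outside ∷_)) + ∑ᴸ (allSubsets m) (f ∘ (inside ∷_))
      ≈⟨ +-cong (∑ᴸ-allSubsets _ λ S → f≈0 (outside ∷ S))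
                (∑ᴸ-allSubsets-⊥ _ λ S ∣S∣≰0 → f≈0 (inside ∷ S) (∣S∣≰0 ∘ ℕ.s≤s⁻¹)) ⟩
    f ⊥ + ∑[ c < m ] f (outside ∷ ⁅ c ⁆) + f (inside ∷ ⊥)
      ≈⟨ +-assoc _ _ _ ⟩
    f ⊥ + (∑[ c < m ] f (outside ∷ ⁅ c ⁆) + f (inside ∷ ⊥))
      ≈⟨ +-congˡ (+-comm _ _) ⟩
    f ⊥ + (f (inside ∷ ⊥) + ∑[ c < m ] f (outside ∷ ⁅ c ⁆)) ∎

  ∑-𝟙-∈ : (a : Subset m) → ∑[ c < m ] 𝟙 (c ∈? a) ≈ ⟦ ∣ a ∣ ⟧
  ∑-𝟙-∈ []            = refl
  ∑-𝟙-∈ (outside ∷ a) = trans (+-identityˡ _) (∑-𝟙-∈ a)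
  ∑-𝟙-∈ (inside ∷ a)  = +-congˡ (∑-𝟙-∈ a)

  -- The weight under a shift by one position.

  -- Prepending a position moves each dimer of `D` one step to the right, which adds 1 per dimer.
  sumOfPositions-∷ : (S : Subset m) (D : DimerSet m n) →
    sumOfPositions (S ∷ D) ≡ ∣ S ∣ ℕ.+ (numberOfDimers D ℕ.+ sumOfPositions D)
  sumOfPositions-∷ S D = ≡.cong₂ ℕ._+_ (ℕ.*-identityˡ ∣ S ∣)
    (sum-suc-* position (λ i → ∣ lookup D i ∣))
    where
    -- Stated for arbitrary `p` because the induction replaces `position` by `position ∘ suc`.
    sum-suc-* : ∀ {n} (p g : Fin n → ℕ) → Vec.sum (Vec.tabulate λ i → suc (p i) ℕ.* g i) ≡
                Vec.sum (Vec.tabulate g) ℕ.+ Vec.sum (Vec.tabulate λ i → p i ℕ.* g i)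
    sum-suc-* {zero}  p g = ≡.refl
    sum-suc-* {suc n} p g = ≡.trans
      (≡.cong (suc (p zero) ℕ.* g zero ℕ.+_) (sum-suc-* (p ∘ suc) (g ∘ suc)))
      (ℕ-interchange (g zero) _ _ _)
      where open import Algebra.Properties.CommutativeSemigroup ℕ.+-commutativeSemigroup
                   using () renaming (interchange to ℕ-interchange)

  module _ (s : Carrier) where

    -- The shift gives every dimer of `D` one more factor `s`, which is absorbed into `r`; this is
    -- the source of the substitution of `r * s` for `r`.
    weight-∷ : ∀ r (S : Subset m) (D : DimerSet m n) →
               weight r s (S ∷ D) ≈ (r * s) ^ ∣ S ∣ * weight (r * s) s D
    weight-∷ r S D = begin
      r ^ (d ℕ.+ b) * s ^ sumOfPositions (S ∷ D)
        ≡⟨ ≡.cong (λ e → r ^ (d ℕ.+ b) * s ^ e) (sumOfPositions-∷ S D) ⟩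
      r ^ (d ℕ.+ b) * s ^ (d ℕ.+ (b ℕ.+ c))
        ≈⟨ *-cong (^-homo-* r d b) (trans (^-homo-* s d _) (*-congˡ (^-homo-* s b c))) ⟩
      (r ^ d * r ^ b) * (s ^ d * (s ^ b * s ^ c))
        ≈⟨ solve 5 (λ rk rb sk sb sc → (rk :* rb) :* (sk :* (sb :* sc)) :=
                     (rk :* sk) :* ((rb :* sb) :* sc)) refl _ _ _ _ _ ⟩
      (r ^ d * s ^ d) * ((r ^ b * s ^ b) * s ^ c)
        ≈⟨ *-cong (^-distrib-* r s d) (*-congʳ (^-distrib-* r s b)) ⟨
      (r * s) ^ d * ((r * s) ^ b * s ^ c) ∎
      where
      d b c : ℕ
      d = ∣ S ∣
      b = numberOfDimers D
      c = sumOfPositions D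

    -- The linear system obtained by peeling off the first position.

    module _ (m : ℕ) where

      -- The configurations following two positions that carry i and j dimers (0 or 1 each).
      T : ℕ → ℕ → ℕ → Carrier → Carrier
      T i j zero    r = 1#
      T i j (suc n) r = T j 0 n (r * s) + (⟦ m ⟧ - ⟦ i ℕ.+ j ⟧) * (r * s) * T j 1 n (r * s)

      T-cong : ∀ i j n {r r′} → r ≈ r′ → T i j n r ≈ T i j n r′
      T-cong i j zero    eq = refl
      T-cong i j (suc n) eq = +-cong (T-cong j 0 n (*-congʳ eq))
        (*-cong (*-congˡ (*-congʳ eq)) (T-cong j 1 n (*-congʳ eq)))

      -- Admissibility makes `a` and `b` disjoint, so each colour is exactly one of: allowed next,
      -- in `a`, in `b`. The three indicators thus add up to 1.
      ∑-𝟙-extend-⁅⁆ : {a b : Subset m} → Admissible (a ∷ b ∷ []) →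
        ∑[ c < m ] 𝟙 (admissible? (a ∷ b ∷ ⁅ c ⁆ ∷ [])) ≈ ⟦ m ⟧ - ⟦ ∣ a ∣ ℕ.+ ∣ b ∣ ⟧
      ∑-𝟙-extend-⁅⁆ {a} {b} adm = x+y≈z⇒x≈z-y (begin
        sum new + ⟦ ∣ a ∣ ℕ.+ ∣ b ∣ ⟧
          ≈⟨ +-congˡ (×-homo-+ 1# ∣ a ∣ ∣ b ∣) ⟩
        sum new + (⟦ ∣ a ∣ ⟧ + ⟦ ∣ b ∣ ⟧)
          ≈⟨ +-congˡ (+-cong (∑-𝟙-∈ a) (∑-𝟙-∈ b)) ⟨
        sum new + (sum in-a + sum in-b)
          ≈⟨ trans (∑-distrib-+ new _) (+-congˡ (∑-distrib-+ in-a in-b)) ⟨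
        ∑[ c < m ] (new c + (in-a c + in-b c))
          ≈⟨ sum-cong-≋ partition ⟩
        ∑[ c < m ] 1#
          ≈⟨ sum-replicate m ⟩
        ⟦ m ⟧ ∎)
        where
        new in-a in-b : Fin m → Carrier
        new  c = 𝟙 (admissible? (a ∷ b ∷ ⁅ c ⁆ ∷ []))
        in-a c = 𝟙 (c ∈? a)
        in-b c = 𝟙 (c ∈? b)

        partition : ∀ c → new c + (in-a c + in-b c) ≈ 1#
        partition c with c ∈? a | c ∈? b
        ... | yes c∈a | yes c∈b = ⊥-elim (admissible⇒disjoint adm c∈a c∈b)
        ... | yes c∈a | no  _   = trans
          (+-cong (𝟙-false (admissible? (a ∷ b ∷ ⁅ c ⁆ ∷ [])) λ adm′ → proj₁ (admissible-extend-⁅⁆⁻ adm′) c∈a) (+-identityʳ _))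
          (+-identityˡ _)
        ... | no  _   | yes c∈b = trans
          (+-cong (𝟙-false (admissible? (a ∷ b ∷ ⁅ c ⁆ ∷ [])) λ adm′ → proj₂ (admissible-extend-⁅⁆⁻ adm′) c∈b) (+-identityˡ _))
          (+-identityˡ _)
        ... | no  c∉a | no  c∉b = trans
          (+-cong (𝟙-true (admissible? (a ∷ b ∷ ⁅ c ⁆ ∷ [])) (admissible-extend-⁅⁆ adm c∉a c∉b)) (+-identityˡ _))
          (+-identityʳ _)

      -- Only `D` is weighted; `a` and `b` act as a boundary condition.
      extensions : (a b : Subset m) (n : ℕ) → Carrier → Carrier
      extensions a b n r =
        ∑ᴸ (allVecs (allSubsets m) n) λ D → 𝟙 (admissible? (a ∷ b ∷ D)) * weight r s D

      -- Induction on `n`: an admissible next set `S` moves the window from `a`, `b` to `b`, `S`,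
      -- and an inadmissible one contributes 0. The sizes enter through equations since `∣ ⊥ ∣`
      -- equals 0 only propositionally.
      extensions≈T : ∀ n r {a b : Subset m} {i j} → ∣ a ∣ ≡ i → ∣ b ∣ ≡ j →
                     Admissible (a ∷ b ∷ []) → extensions a b n r ≈ T i j n r
      extensions≈T zero    r {a} {b} _ _ adm = trans (+-identityʳ _)
        (trans (*-cong (𝟙-true (admissible? (a ∷ b ∷ [])) adm) (*-identityˡ 1#)) (*-identityˡ 1#))
      extensions≈T (suc n) r {a} {b} ≡.refl ≡.refl adm = begin
        extensions a b (suc n) r
          ≈⟨ ∑ᴸ-cartesianProductWith _∷_ (allSubsets m) (allVecs (allSubsets m) n) ⟩
        ∑ᴸ (allSubsets m) startingWith
          -- Index `suc (suc zero)` is that of `S`, behind `a` and `b`; C1 there excludes more than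
          -- one colour.
          ≈⟨ ∑ᴸ-allSubsets startingWith (λ S ∣S∣≰1 → startingWith-inadmissible λ adm′ →
               ∣S∣≰1 (proj₁ adm′ (suc (suc zero)))) ⟩
        startingWith ⊥ + ∑[ c < m ] startingWith ⁅ c ⁆
          ≈⟨ +-cong startingWith-⊥ (sum-cong-≋ λ c → startingWith-⁅⁆ c (admissible? (a ∷ b ∷ ⁅ c ⁆ ∷ []))) ⟩
        T j 0 n x + ∑[ c < m ] (𝟙 (admissible? (a ∷ b ∷ ⁅ c ⁆ ∷ [])) * (x * T j 1 n x))
          ≈⟨ +-congˡ (*-distribʳ-sum _ (λ c → 𝟙 (admissible? (a ∷ b ∷ ⁅ c ⁆ ∷ [])))) ⟨
        T j 0 n x + (∑[ c < m ] 𝟙 (admissible? (a ∷ b ∷ ⁅ c ⁆ ∷ []))) * (x * T j 1 n x)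
          ≈⟨ +-congˡ (trans (*-congʳ (∑-𝟙-extend-⁅⁆ adm)) (sym (*-assoc _ _ _))) ⟩
        T (∣ a ∣) j (suc n) r ∎
        where
        x : Carrier
        x = r * s

        j : ℕ
        j = ∣ b ∣

        startingWith : Subset m → Carrier
        startingWith S = ∑ᴸ (allVecs (allSubsets m) n) λ D →
          𝟙 (admissible? (a ∷ b ∷ S ∷ D)) * weight r s (S ∷ D)

        startingWith-inadmissible : ∀ {S} → ¬ Admissible (a ∷ b ∷ S ∷ []) → startingWith S ≈ 0#
        startingWith-inadmissible {S} ¬adm = ∑ᴸ-zero (allVecs (allSubsets m) n) λ D →
          trans (*-congʳ (𝟙-false (admissible? (a ∷ b ∷ S ∷ D)) (¬adm ∘ admissible-++⁻ (a ∷ b ∷ S ∷ []))))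
                (zeroˡ _)

        startingWith-admissible : ∀ {S d} → ∣ S ∣ ≡ d → Admissible (a ∷ b ∷ S ∷ []) →
                                  startingWith S ≈ x ^ d * T j d n x
        startingWith-admissible {S} ≡.refl adm′ = begin
          startingWith S
            ≈⟨ ∑ᴸ-cong (allVecs (allSubsets m) n) (λ D → begin
                 𝟙 (admissible? (a ∷ b ∷ S ∷ D)) * weight r s (S ∷ D)
                   ≈⟨ *-cong (𝟙-cong (admissible? (a ∷ b ∷ S ∷ D)) (admissible? (b ∷ S ∷ D)) (admissible-window D adm′))
                             (weight-∷ r S D) ⟩
                 𝟙 (admissible? (b ∷ S ∷ D)) * (x ^ ∣ S ∣ * weight x s D)
                   ≈⟨ solve 3 (λ u v w → u :* (v :* w) := v :* (u :* w)) refl _ _ _ ⟩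
                 x ^ ∣ S ∣ * (𝟙 (admissible? (b ∷ S ∷ D)) * weight x s D) ∎) ⟩
          ∑ᴸ (allVecs (allSubsets m) n)
             (λ D → x ^ ∣ S ∣ * (𝟙 (admissible? (b ∷ S ∷ D)) * weight x s D))
            ≈⟨ *-distribˡ-∑ᴸ (x ^ ∣ S ∣) (allVecs (allSubsets m) n) ⟩
          x ^ ∣ S ∣ * extensions b S n x
            ≈⟨ *-congˡ (extensions≈T n x ≡.refl ≡.refl (proj₂ (proj₂ (admissible-∷⁻ adm′)))) ⟩
          x ^ ∣ S ∣ * T j (∣ S ∣) n x ∎

        startingWith-⊥ : startingWith ⊥ ≈ T j 0 n x
        startingWith-⊥ = trans (startingWith-admissible (∣⊥∣≡0 m) (admissible-extend-⊥ adm))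
                               (*-identityˡ _)

        -- The decision is an argument so that `𝟙` reduces once its outcome is matched.
        startingWith-⁅⁆ : ∀ c (adm? : Dec (Admissible (a ∷ b ∷ ⁅ c ⁆ ∷ []))) →
                          startingWith ⁅ c ⁆ ≈ 𝟙 adm? * (x * T j 1 n x)
        startingWith-⁅⁆ c (no ¬adm)  = trans (startingWith-inadmissible ¬adm) (sym (zeroˡ _))
        startingWith-⁅⁆ c (yes adm′) = begin
          startingWith ⁅ c ⁆        ≈⟨ startingWith-admissible (∣⁅x⁆∣≡1 c) adm′ ⟩
          x * 1# * T j 1 n x        ≈⟨ *-congʳ (*-identityʳ x) ⟩
          x * T j 1 n x             ≈⟨ *-identityˡ _ ⟨
          1# * (x * T j 1 n x)      ∎

      -- Two empty positions placed in front of the segment impose no constraint.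
      G≈T : ∀ n r → G⁽²⁾ (ℤ.+ n) m r s ≈ T 0 0 n r
      G≈T n r = begin
        G⁽²⁾ (ℤ.+ n) m r s
          ≈⟨ ∑ᴸ-filter admissible? (allVecs (allSubsets m) n) ⟩
        ∑ᴸ (allVecs (allSubsets m) n) (λ D → 𝟙 (admissible? D) * weight r s D)
          ≈⟨ ∑ᴸ-cong (allVecs (allSubsets m) n) (λ D → *-congʳ (trans
               (𝟙-cong (admissible? D) (admissible? (⊥ ∷ D)) admissible-⊥∷)
               (𝟙-cong (admissible? (⊥ ∷ D)) (admissible? (⊥ ∷ ⊥ ∷ D)) admissible-⊥∷))) ⟩
        extensions ⊥ ⊥ n r
          ≈⟨ extensions≈T n r (∣⊥∣≡0 m) (∣⊥∣≡0 m) (to admissible-⊥∷ (to admissible-⊥∷ admissible-[])) ⟩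
        T 0 0 n r ∎
        where open Equivalence using (to)

      G-cong : ∀ i {r r′} → r ≈ r′ → G⁽²⁾ i m r s ≈ G⁽²⁾ i m r′ s
      G-cong (ℤ.+ n)    eq = trans (G≈T n _) (trans (T-cong 0 0 n eq) (sym (G≈T n _)))
      G-cong ℤ.-[1+ _ ] eq = refl

      -- Elimination of the auxiliary functions in favour of `G`.

      -- In terms of q = m − 2 all identities below are free of subtraction, hence valid in every
      -- commutative semiring.
      q : Carrier
      q = ⟦ m ⟧ - ⟦ 2 ⟧

      ⟦m⟧-⟦1⟧≈q+1 : ⟦ m ⟧ - ⟦ 1 ⟧ ≈ q + 1#
      ⟦m⟧-⟦1⟧≈q+1 = sym (x+y≈z⇒x≈z-y (trans (+-assoc q 1# ⟦ 1 ⟧) (//-rightDividesˡ ⟦ 2 ⟧ ⟦ m ⟧)))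

      ⟦m⟧-⟦0⟧≈q+1+1 : ⟦ m ⟧ - ⟦ 0 ⟧ ≈ q + 1# + 1#
      ⟦m⟧-⟦0⟧≈q+1+1 = sym (x+y≈z⇒x≈z-y (begin
        q + 1# + 1# + 0#  ≈⟨ trans (+-assoc _ 1# 0#) (+-assoc q 1# ⟦ 1 ⟧) ⟩
        q + ⟦ 2 ⟧         ≈⟨ //-rightDividesˡ ⟦ 2 ⟧ ⟦ m ⟧ ⟩
        ⟦ m ⟧             ∎))

      T₀₀-suc : ∀ n r → T 0 0 (suc n) r ≈ T 0 0 n (r * s) + (q + 1# + 1#) * (r * s) * T 0 1 n (r * s)
      T₀₀-suc n r = +-congˡ (*-congʳ (*-congʳ ⟦m⟧-⟦0⟧≈q+1+1))

      T₁₀-suc : ∀ n r → T 1 0 (suc n) r ≈ T 0 0 n (r * s) + (q + 1#) * (r * s) * T 0 1 n (r * s)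
      T₁₀-suc n r = +-congˡ (*-congʳ (*-congʳ ⟦m⟧-⟦1⟧≈q+1))

      T₀₁-suc : ∀ n r → T 0 1 (suc n) r ≈ T 1 0 n (r * s) + (q + 1#) * (r * s) * T 1 1 n (r * s)
      T₀₁-suc n r = +-congˡ (*-congʳ (*-congʳ ⟦m⟧-⟦1⟧≈q+1))

      G : ℤ → Carrier → Carrier
      G i r = G⁽²⁾ i m r s

      -- `T 0 0` and `T 1 0` unfold to the same two terms, with `T 0 1` weighted by m and m - 1;
      -- cancelling `T 0 1` leaves one copy of `T 0 0`.
      T₁₀-relation : ∀ n r → (q + 1# + 1#) * T 1 0 n r ≈ (q + 1#) * T 0 0 n r + G (n ⊖ 1) (r * s)
      -- `0 ⊖ 1` is negative, so `G` takes its conventional value 1 there.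
      T₁₀-relation zero r =
        solve 1 (λ q → (q :+ con 1 :+ con 1) :* con 1 := (q :+ con 1) :* con 1 :+ con 1) refl q
      T₁₀-relation (suc n) r = begin
        (q + 1# + 1#) * T 1 0 (suc n) r
          ≈⟨ *-congˡ (T₁₀-suc n r) ⟩
        (q + 1# + 1#) * (T 0 0 n x + (q + 1#) * x * T 0 1 n x)
          ≈⟨ solve 4 (λ q x g h →
               (q :+ con 1 :+ con 1) :* (g :+ (q :+ con 1) :* x :* h) :=
               (q :+ con 1) :* (g :+ (q :+ con 1 :+ con 1) :* x :* h) :+ g) refl _ _ _ _ ⟩
        (q + 1#) * (T 0 0 n x + (q + 1# + 1#) * x * T 0 1 n x) + T 0 0 n x
          ≈⟨ +-cong (*-congˡ (T₀₀-suc n r)) (G≈T n x) ⟨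
        (q + 1#) * T 0 0 (suc n) r + G (suc n ⊖ 1) x ∎
        where
        x : Carrier
        x = r * s

      -- `T 0 1` and `T 1 1` unfold to the same two terms, with `T 1 1` weighted by m - 1 and q;
      -- cancelling it leaves `T 1 0`, and the factor m makes `T₁₀-relation` applicable.
      T₁₁-relation : ∀ n r → (q + 1# + 1#) * (q + 1#) * T 1 1 n r ≈
        (q + 1# + 1#) * q * T 0 1 n r + (q + 1#) * G (n ⊖ 1) (r * s) + G (n ⊖ 2) (r * s * s)
      T₁₁-relation zero r =
        solve 1 (λ q → (q :+ con 1 :+ con 1) :* (q :+ con 1) :* con 1 :=
          (q :+ con 1 :+ con 1) :* q :* con 1 :+ (q :+ con 1) :* con 1 :+ con 1) refl q
      T₁₁-relation (suc n) r = begin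
        -- The coefficient `⟦ m ⟧ - ⟦ 1 ℕ.+ 1 ⟧` is `q` by definition.
        (q + 1# + 1#) * (q + 1#) * (T 1 0 n x + q * x * T 1 1 n x)
          ≈⟨ solve 4 (λ q x k l →
               (q :+ con 1 :+ con 1) :* (q :+ con 1) :* (k :+ q :* x :* l) :=
               (q :+ con 1 :+ con 1) :* q :* (k :+ (q :+ con 1) :* x :* l) :+
               (q :+ con 1 :+ con 1) :* k) refl _ _ _ _ ⟩
        (q + 1# + 1#) * q * (T 1 0 n x + (q + 1#) * x * T 1 1 n x) + (q + 1# + 1#) * T 1 0 n x
          ≈⟨ +-cong (*-congˡ (sym (T₀₁-suc n r))) (T₁₀-relation n x) ⟩
        (q + 1# + 1#) * q * T 0 1 (suc n) r + ((q + 1#) * T 0 0 n x + G (n ⊖ 1) (x * s))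
          ≈⟨ +-assoc _ _ _ ⟨
        (q + 1# + 1#) * q * T 0 1 (suc n) r + (q + 1#) * T 0 0 n x + G (n ⊖ 1) (x * s)
          ≈⟨ +-cong (+-congˡ (*-congˡ (sym (G≈T n x))))
                    (reflexive (≡.cong (λ i → G i (x * s)) (≡.sym (ℤ.[1+m]⊖[1+n]≡m⊖n n 1)))) ⟩
        (q + 1# + 1#) * q * T 0 1 (suc n) r + (q + 1#) * G (suc n ⊖ 1) x + G (suc n ⊖ 2) (x * s) ∎
        where
        x : Carrier
        x = r * s

      -- The factors m and m (m - 1) required by the two relations are both present after one
      -- unfolding, so nothing is divided; the remaining `T 0 1 n` recombines with `T 0 0 n` into
      -- `T 0 0 (suc n)`.
      T₀₁-relation : ∀ n r → (q + 1# + 1#) * T 0 1 (suc n) r ≈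
        q * T 0 0 (suc n) r + T 0 0 n (r * s)
          + (1# + (q + 1#) * (r * s)) * G (n ⊖ 1) (r * s * s) + r * s * G (n ⊖ 2) (r * s * s * s)
      T₀₁-relation n r = begin
        (q + 1# + 1#) * T 0 1 (suc n) r
          ≈⟨ *-congˡ (T₀₁-suc n r) ⟩
        (q + 1# + 1#) * (T 1 0 n x + (q + 1#) * x * T 1 1 n x)
          ≈⟨ solve 4 (λ q x k l →
               (q :+ con 1 :+ con 1) :* (k :+ (q :+ con 1) :* x :* l) :=
               (q :+ con 1 :+ con 1) :* k :+ x :* ((q :+ con 1 :+ con 1) :* (q :+ con 1) :* l))
               refl _ _ _ _ ⟩
        (q + 1# + 1#) * T 1 0 n x + x * ((q + 1# + 1#) * (q + 1#) * T 1 1 n x)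
          ≈⟨ +-cong (T₁₀-relation n x) (*-congˡ (T₁₁-relation n x)) ⟩
        ((q + 1#) * T 0 0 n x + G₁) + x * ((q + 1# + 1#) * q * T 0 1 n x + (q + 1#) * G₁ + G₂)
          ≈⟨ solve 6 (λ q x g h g₁ g₂ →
               ((q :+ con 1) :* g :+ g₁) :+
                 x :* ((q :+ con 1 :+ con 1) :* q :* h :+ (q :+ con 1) :* g₁ :+ g₂) :=
               q :* (g :+ (q :+ con 1 :+ con 1) :* x :* h) :+ g :+
                 (con 1 :+ (q :+ con 1) :* x) :* g₁ :+ x :* g₂) refl _ _ _ _ _ _ ⟩
        q * (T 0 0 n x + (q + 1# + 1#) * x * T 0 1 n x) + T 0 0 n x
          + (1# + (q + 1#) * x) * G₁ + x * G₂
          ≈⟨ +-congʳ (+-congʳ (+-congʳ (*-congˡ (T₀₀-suc n r)))) ⟨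
        q * T 0 0 (suc n) r + T 0 0 n x + (1# + (q + 1#) * x) * G₁ + x * G₂ ∎
        where
        x G₁ G₂ : Carrier
        x  = r * s
        G₁ = G (n ⊖ 1) (x * s)
        G₂ = G (n ⊖ 2) (x * s * s)

      -- The recurrence and the initial values.

      2+m⊖2+n≡m⊖n : ∀ m n → suc (suc m) ⊖ suc (suc n) ≡ m ⊖ n
      2+m⊖2+n≡m⊖n m n = ≡.trans (ℤ.[1+m]⊖[1+n]≡m⊖n (suc m) (suc n)) (ℤ.[1+m]⊖[1+n]≡m⊖n m n)

      -- The indices use `⊖` because subtracting a positive integer from `ℤ.+ suc (suc n)` computes
      -- to this form.
      G-recurrence : ∀ n r → G (ℤ.+ suc (suc n)) r ≈
          (1# + r * s * (⟦ m ⟧ - ⟦ 2 ⟧)) * G (suc (suc n) ⊖ 1) (r * s)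
        + r * s * G (suc (suc n) ⊖ 2) (r * s ^ 2)
        + r * s * (1# + r * s ^ 2 * (⟦ m ⟧ - ⟦ 1 ⟧)) * G (suc (suc n) ⊖ 3) (r * s ^ 3)
        + r ^ 2 * s ^ 3 * G (suc (suc n) ⊖ 4) (r * s ^ 4)
      G-recurrence n r = begin
        G (ℤ.+ suc (suc n)) r
          ≈⟨ G≈T (suc (suc n)) r ⟩
        T 0 0 (suc (suc n)) r
          ≈⟨ T₀₀-suc (suc n) r ⟩
        T 0 0 (suc n) x + (q + 1# + 1#) * x * T 0 1 (suc n) x
          -- Attaches the factor m to `T 0 1`, since it is this multiple that `T₀₁-relation`
          -- expresses through `G`.
          ≈⟨ +-congˡ (solve 3 (λ c x h → c :* x :* h := x :* (c :* h)) refl _ _ _) ⟩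
        T 0 0 (suc n) x + x * ((q + 1# + 1#) * T 0 1 (suc n) x)
          ≈⟨ +-congˡ (*-congˡ (T₀₁-relation n x)) ⟩
        T 0 0 (suc n) x + x * (q * T 0 0 (suc n) x + T 0 0 n (x * s)
          + (1# + (q + 1#) * (x * s)) * G (n ⊖ 1) (x * s * s) + x * s * G (n ⊖ 2) (x * s * s * s))
          ≈⟨ solve 7 (λ r s q g₁ g₂ g₃ g₄ → let x = r :* s in
               g₁ :+ x :* (q :* g₁ :+ g₂ :+ (con 1 :+ (q :+ con 1) :* (x :* s)) :* g₃ :+ x :* s :* g₄) :=
               (con 1 :+ x :* q) :* g₁ :+ x :* g₂
                 :+ x :* (con 1 :+ r :* s :^ 2 :* (q :+ con 1)) :* g₃ :+ r :^ 2 :* s :^ 3 :* g₄)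
               refl r s q _ _ _ _ ⟩
        (1# + x * q) * T 0 0 (suc n) x + x * T 0 0 n (x * s)
          + x * (1# + r * s ^ 2 * (q + 1#)) * G (n ⊖ 1) (x * s * s)
          + r ^ 2 * s ^ 3 * G (n ⊖ 2) (x * s * s * s)
          ≈⟨ +-cong (+-cong (+-cong (*-congˡ (sym (G≈T (suc n) x)))
                                    (*-congˡ (trans (sym (G≈T n (x * s))) (G-cong (ℤ.+ n) xs≈rs²))))
                            (*-cong (*-congˡ (+-congˡ (*-congˡ (sym ⟦m⟧-⟦1⟧≈q+1)))) (G-shift 1 xss≈rs³)))
                    (*-congˡ (G-shift 2 xsss≈rs⁴)) ⟩
        _ ∎
        where
        x : Carrier
        x = r * s

        xs≈rs² : x * s ≈ r * s ^ 2
        xs≈rs² = solve 2 (λ r s → r :* s :* s := r :* s :^ 2) refl r s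

        xss≈rs³ : x * s * s ≈ r * s ^ 3
        xss≈rs³ = solve 2 (λ r s → r :* s :* s :* s := r :* s :^ 3) refl r s

        xsss≈rs⁴ : x * s * s * s ≈ r * s ^ 4
        xsss≈rs⁴ = solve 2 (λ r s → r :* s :* s :* s :* s := r :* s :^ 4) refl r s

        G-shift : ∀ d {r₁ r₂} → r₁ ≈ r₂ → G (n ⊖ d) r₁ ≈ G (suc (suc n) ⊖ suc (suc d)) r₂
        G-shift d eq = trans (G-cong (n ⊖ d) eq)
          (reflexive (≡.cong (λ i → G i _) (≡.sym (2+m⊖2+n≡m⊖n n d))))

      G-nonpositive : ∀ r i → i ℤ.≤ 0ℤ → G i r ≈ 1#
      G-nonpositive r (ℤ.+ zero)   _ = G≈T 0 r
      G-nonpositive r ℤ.-[1+ _ ]   _ = refl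
      G-nonpositive r (ℤ.+ suc _) (ℤ.+≤+ ())

      G-one : ∀ r → G 1ℤ r ≈ 1# + r * s * ⟦ m ⟧
      G-one r = begin
        G 1ℤ r                                       ≈⟨ G≈T 1 r ⟩
        1# + (⟦ m ⟧ - 0#) * (r * s) * 1#             ≈⟨ +-congˡ (*-identityʳ _) ⟩
        1# + (⟦ m ⟧ - 0#) * (r * s)                  ≈⟨ +-congˡ (*-congʳ m-0≈m) ⟩
        1# + ⟦ m ⟧ * (r * s)                         ≈⟨ +-congˡ (*-comm _ _) ⟩
        1# + r * s * ⟦ m ⟧                           ∎
        where
        m-0≈m : ⟦ m ⟧ - 0# ≈ ⟦ m ⟧
        m-0≈m = sym (x+y≈z⇒x≈z-y (+-identityʳ ⟦ m ⟧))

proposition3p9 :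
  ∀ {a ℓ} (R : CommutativeRing a ℓ) →
  let open CommutativeRing R
      open GeneratingFunction R
  in
  (m : ℕ) →
  ((r s : Carrier) (n : ℤ) → ℤ.+ 2 ℤ.≤ n →
    G⁽²⁾ n m r s ≈
        (1# + r * s * (⟦ m ⟧ - ⟦ 2 ⟧)) * G⁽²⁾ (n ℤ.- ℤ.+ 1) m (r * s) s
      + r * s * G⁽²⁾ (n ℤ.- ℤ.+ 2) m (r * s ^ 2) s
      + r * s * (1# + r * s ^ 2 * (⟦ m ⟧ - ⟦ 1 ⟧)) * G⁽²⁾ (n ℤ.- ℤ.+ 3) m (r * s ^ 3) s
      + r ^ 2 * s ^ 3 * G⁽²⁾ (n ℤ.- ℤ.+ 4) m (r * s ^ 4) s)
  × ((r s : Carrier) (i : ℤ) → i ℤ.≤ 0ℤ → G⁽²⁾ i m r s ≈ 1#)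
  × ((r s : Carrier) → G⁽²⁾ 1ℤ m r s ≈ 1# + r * s * ⟦ m ⟧)
proposition3p9 R m =
  (λ { r s (ℤ.+ 0) (ℤ.+≤+ ())
     ; r s (ℤ.+ 1) (ℤ.+≤+ (s≤s ()))
     ; r s (ℤ.+ suc (suc n)) _ → G-recurrence R s m n r }) ,
  (λ r s → G-nonpositive R s m r) ,
  (λ r s → G-one R s m r)
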